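{- Let $L$ be a bounded lattice and let $\to$ be a preconditional on $L$. For $a\in L$ let $\widehat{a}=\{(F,I)\in X\mid a\in F\}$, where $\mathsf{FI}(L,\to)=(X,\vartriangleleft)$ is the relational frame of consonant filter-ideal pairs of $(L,\to)$. Then the map $a\mapsto\widehat{a}$ is 1. an embedding of $(L,\to)$ into $(\mathfrak{L}(\mathsf{FI}(L,\to)),\to_\vartriangleleft)$ (as bounded lattices with an additional binary operation), and 2. an isomorphism from $L$ to the subalgebra of $(\mathfrak{L}(\mathsf{FI}(L,\to)),\to_\vartriangleleft)$ consisting of those elements of $\mathfrak{L}(\mathsf{FI}(L,\to))$ that are compact open in the space $\mathsf{S}(L,\to)$.
   Context: A preconditional on a bounded lattice $L$ is a binary operation $\to$ on $L$ such that for all $a,b,c\in L$: (1) $1\to a\leq a$; (2) $a\wedge b\leq a\to b$; (3) $a\to b\leq a\to(a\wedge b)$; (4) $a\to(b\wedge c)\leq a\to b$; (5) $a\to((a\wedge b)\to c)\leq (a\wedge b)\to c$. Given a set $X$ and a binary relation $\vartriangleleft$ on $X$, with converse $\vartriangleright$, define for $A,B\subseteq X$ $$A\to_\vartriangleleft B=\{x\in X\mid \forall y\vartriangleleft x\,(y\in A\Rightarrow \exists z\vartriangleright y:\ z\in A\cap B)\}.$$ The map $c_\vartriangleleft(A)=X\to_\vartriangleleft A$ is a closure operator on $\wp(X)$. $\mathfrak{L}(X,\vartriangleleft)$ is the complete lattice of its fixpoints ordered by inclusion, with meet given by intersection, join $\bigvee_\vartriangleleft\{A_i\mid i\in I\}=c_\vartriangleleft(\bigcup\{A_i\mid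 i\in I\})$, top $X$ and bottom $c_\vartriangleleft(\varnothing)$. It is closed under $\to_\vartriangleleft$, so $\to_\vartriangleleft$ is regarded as an operation on it. Given a bounded lattice $L$ with preconditional $\to$, a consonant filter-ideal pair is a pair $(F,I)$ with $F$ a filter in $L$ and $I$ an ideal in $L$ (filters and ideals are not required to be proper) such that for all $a,b\in L$: if $a\in F$ and $a\wedge b\in I$, then $a\to b\in I$. The frame $\mathsf{FI}(L,\to)=(X,\vartriangleleft)$ has $X$ the set of all consonant filter-ideal pairs of $L$, with $(F,I)\vartriangleleft(F',I')$ iff $I\cap F'=\varnothing$. $\mathsf{S}(L,\to)$ is $\mathsf{FI}(L,\to)$ endowed with the topology generated by $\{\widehat{a}\mid a\in L\}$. -}

module Defs where

open import Algebra.Core using (Op₂)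
open import Algebra.Definitions using (Congruent₂)
open import Algebra.Lattice.Bundles using (RawLattice)
open import Algebra.Lattice.Morphism.Structures using (IsLatticeHomomorphism)
open import Data.List.Base using (List)
open import Data.List.Relation.Unary.Any using (Any)
open import Data.Product.Base using (Σ; Σ-syntax; ∃; _×_; _,_; proj₁; proj₂)
open import Data.Sum.Base using ([_,_]; inj₁; inj₂)
open import Function.Base using (_∘_; _on_)
open import Function.Definitions using (Injective; Surjective)
open import Level using (Level; _⊔_; suc; Lift)
open import Relation.Binary.Core using (Rel)
open import Relation.Binary.Lattice.Bundles using (BoundedLattice)
import Relation.Binary.Construct.On as On
open import Relation.Unary using (Pred; _∈_; _⊆_; _≐_; _∩_; _∪_; _⊥_; ⋃)
open import Relation.Unary.Polymorphic using (U; ∅)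
open import Relation.Unary.Relation.Binary.Subset using (⊆-isPartialOrder)

private
  variable
    x ℓ j c ℓ₁ ℓ₂ c′ ℓ₁′ ℓ₂′ : Level

record LatticeWithOp c ℓ₁ ℓ₂ : Set (suc (c ⊔ ℓ₁ ⊔ ℓ₂)) where
  infixr 5 _⇒_
  field
    boundedLattice : BoundedLattice c ℓ₁ ℓ₂
  open BoundedLattice boundedLattice public
  field
    _⇒_    : Op₂ Carrier
    ⇒-cong : Congruent₂ _≈_ _⇒_

  rawLattice : RawLattice c ℓ₁
  rawLattice = record { _≈_ = _≈_ ; _∧_ = _∧_ ; _∨_ = _∨_ }

module _ (A : LatticeWithOp c ℓ₁ ℓ₂) (B : LatticeWithOp c′ ℓ₁′ ℓ₂′) where
  private
    module A = LatticeWithOp A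
    module B = LatticeWithOp B

  record IsHomomorphism (h : A.Carrier → B.Carrier) : Set (c ⊔ ℓ₁ ⊔ ℓ₁′) where
    field
      isLatticeHomomorphism : IsLatticeHomomorphism A.rawLattice B.rawLattice h
      ⊤-homo : h A.⊤ B.≈ B.⊤
      ⊥-homo : h A.⊥ B.≈ B.⊥
      ⇒-homo : ∀ a b → h (a A.⇒ b) B.≈ (h a B.⇒ h b)

  record IsEmbedding (h : A.Carrier → B.Carrier) : Set (c ⊔ ℓ₁ ⊔ ℓ₁′) where
    field
      isHomomorphism : IsHomomorphism h
      injective      : Injective A._≈_ B._≈_ h

  record IsIsomorphism (h : A.Carrier → B.Carrier) : Set (c ⊔ c′ ⊔ ℓ₁ ⊔ ℓ₁′) where
    field
      isEmbedding : IsEmbedding h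
      surjective  : Surjective A._≈_ B._≈_ h

module _ (A : LatticeWithOp c ℓ₁ ℓ₂) where
  open LatticeWithOp A

  record IsSubuniverse (P : Pred Carrier ℓ) : Set (c ⊔ ℓ) where
    field
      ⊤-closed : ⊤ ∈ P
      ⊥-closed : ⊥ ∈ P
      ∧-closed : ∀ {a b} → a ∈ P → b ∈ P → (a ∧ b) ∈ P
      ∨-closed : ∀ {a b} → a ∈ P → b ∈ P → (a ∨ b) ∈ P
      ⇒-closed : ∀ {a b} → a ∈ P → b ∈ P → (a ⇒ b) ∈ P

  subalgebra : (P : Pred Carrier ℓ) → IsSubuniverse P → LatticeWithOp (c ⊔ ℓ) ℓ₁ ℓ₂
  subalgebra P closed = record
    { boundedLattice = record
      { Carrier = Σ[ a ∈ Carrier ] a ∈ P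
      ; _≈_     = _≈_ on proj₁
      ; _≤_     = _≤_ on proj₁
      ; _∨_     = λ (a , p) (b , q) → a ∨ b , ∨-closed p q
      ; _∧_     = λ (a , p) (b , q) → a ∧ b , ∧-closed p q
      ; ⊤       = ⊤ , ⊤-closed
      ; ⊥       = ⊥ , ⊥-closed
      ; isBoundedLattice = record
        { isLattice = record
          { isPartialOrder = On.isPartialOrder proj₁ isPartialOrder
          ; supremum = λ (a , _) (b , _) →
              x≤x∨y a b , y≤x∨y a b , λ _ → ∨-least
          ; infimum  = λ (a , _) (b , _) →
              x∧y≤x a b , x∧y≤y a b , λ _ → ∧-greatest
          }
        ; maximum = λ (a , _) → maximum a
        ; minimum = λ (a , _) → minimum a
        }
      }
    ; _⇒_    = λ (a , p) (b , q) → (a ⇒ b) , ⇒-closed p q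
    ; ⇒-cong = ⇒-cong
    }
    where open IsSubuniverse closed

module _ (L : BoundedLattice c ℓ₁ ℓ₂) where
  open BoundedLattice L

  record IsPreconditional (_⇒_ : Op₂ Carrier) : Set (c ⊔ ℓ₁ ⊔ ℓ₂) where
    field
      ⇒-cong : Congruent₂ _≈_ _⇒_
      ⊤⇒     : ∀ a → (⊤ ⇒ a) ≤ a
      ∧≤⇒    : ∀ a b → (a ∧ b) ≤ (a ⇒ b)
      ⇒≤⇒∧   : ∀ a b → (a ⇒ b) ≤ (a ⇒ (a ∧ b))
      ⇒∧≤⇒   : ∀ a b d → (a ⇒ (b ∧ d)) ≤ (a ⇒ b)
      ⇒⇒≤⇒ : ∀ a b d → (a ⇒ ((a ∧ b) ⇒ d)) ≤ ((a ∧ b) ⇒ d)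

  withPreconditional : (_⇒_ : Op₂ Carrier) → IsPreconditional _⇒_ →
                       LatticeWithOp c ℓ₁ ℓ₂
  withPreconditional _⇒_ isPreconditional = record
    { boundedLattice = L
    ; _⇒_            = _⇒_
    ; ⇒-cong         = IsPreconditional.⇒-cong isPreconditional
    }

module Frame {x r} {X : Set x} (_◁_ : Rel X r) where

  infixr 5 _⟶_

  -- x ⊔ r is the least level at which subsets of X are closed under _⟶_.
  Subset : Set (suc (x ⊔ r))
  Subset = Pred X (x ⊔ r)

  _⟶_ : Op₂ Subset
  (A ⟶ B) u = ∀ y → y ◁ u → y ∈ A → ∃ λ z → y ◁ z × z ∈ (A ∩ B)

  cl : Subset → Subset
  cl A = U ⟶ A

  IsFixpoint : Pred Subset (x ⊔ r)
  IsFixpoint A = cl A ≐ A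

  Fixpoint : Set (suc (x ⊔ r))
  Fixpoint = Σ[ A ∈ Subset ] IsFixpoint A

  cl-extensive : ∀ A → A ⊆ cl A
  cl-extensive A {u} u∈A y y◁u _ = u , y◁u , _ , u∈A

  cl-mono : ∀ {A B} → A ⊆ B → cl A ⊆ cl B
  cl-mono A⊆B u∈cA y y◁u _ =
    let z , y◁z , _ , z∈A = u∈cA y y◁u _ in z , y◁z , _ , A⊆B z∈A

  cl-idem : ∀ A → cl (cl A) ⊆ cl A
  cl-idem A u∈ccA y y◁u _ =
    let _ , y◁z , _ , z∈cA = u∈ccA y y◁u _ in z∈cA y y◁z _

  cl-isFixpoint : ∀ A → IsFixpoint (cl A)
  cl-isFixpoint A = cl-idem A , cl-extensive (cl A)

  U-isFixpoint : IsFixpoint U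
  U-isFixpoint = _ , cl-extensive U

  ∩-isFixpoint : ∀ {A B} → IsFixpoint A → IsFixpoint B → IsFixpoint (A ∩ B)
  ∩-isFixpoint {A} {B} (cA⊆A , _) (cB⊆B , _) =
    (λ u∈c → cA⊆A (cl-mono proj₁ u∈c) , cB⊆B (cl-mono proj₂ u∈c)) ,
    cl-extensive (A ∩ B)

  ⟶-isFixpoint : ∀ A B → IsFixpoint (A ⟶ B)
  ⟶-isFixpoint A B =
    (λ u∈c y y◁u y∈A →
      let _ , y◁z , _ , z∈A⟶B = u∈c y y◁u _ in z∈A⟶B y y◁z y∈A) ,
    cl-extensive (A ⟶ B)

  ⟶-cong : ∀ {A A′ B B′ : Subset} → A ≐ A′ → B ≐ B′ → (A ⟶ B) ≐ (A′ ⟶ B′)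
  ⟶-cong A≐A′ B≐B′ = mono A≐A′ (proj₁ B≐B′) ,
                     mono (proj₂ A≐A′ , proj₁ A≐A′) (proj₂ B≐B′)
    where
    mono : ∀ {A A′ B B′ : Subset} → A ≐ A′ → B ⊆ B′ → (A ⟶ B) ⊆ (A′ ⟶ B′)
    mono (A⊆A′ , A′⊆A) B⊆B′ u∈ y y◁u y∈A′ =
      let z , y◁z , z∈A , z∈B = u∈ y y◁u (A′⊆A y∈A′)
      in z , y◁z , A⊆A′ z∈A , B⊆B′ z∈B

  𝔏 : LatticeWithOp (suc (x ⊔ r)) (x ⊔ r) (x ⊔ r)
  𝔏 = record
    { boundedLattice = record
      { Carrier = Fixpoint
      ; _≈_     = _≐_ on proj₁
      ; _≤_     = λ A B → proj₁ A ⊆ proj₁ B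
      ; _∨_     = λ (A , _) (B , _) → cl (A ∪ B) , cl-isFixpoint (A ∪ B)
      ; _∧_     = λ (A , fA) (B , fB) → A ∩ B , ∩-isFixpoint fA fB
      ; ⊤       = U , U-isFixpoint
      ; ⊥       = cl ∅ , cl-isFixpoint ∅
      ; isBoundedLattice = record
        { isLattice = record
          { isPartialOrder = On.isPartialOrder proj₁ ⊆-isPartialOrder
          ; supremum = λ (A , _) (B , _) →
              cl-extensive (A ∪ B) ∘ inj₁ ,
              cl-extensive (A ∪ B) ∘ inj₂ ,
              λ (D , cD⊆D , _) A⊆D B⊆D → cD⊆D ∘ cl-mono [ A⊆D , B⊆D ]
          ; infimum  = λ A B →
              proj₁ , proj₂ , λ _ D⊆A D⊆B d → D⊆A d , D⊆B d
          }
        ; maximum = λ _ _ → _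
        ; minimum = λ (_ , cD⊆D , _) → cD⊆D ∘ cl-mono λ ()
        }
      }
    ; _⇒_    = λ (A , _) (B , _) → (A ⟶ B) , ⟶-isFixpoint A B
    ; ⇒-cong = ⟶-cong
    }

-- The least topology containing the sets B i.  Subsets are predicates, so
-- closure under extensional equality has to be stated, and unions range over
-- families indexed at the level of those predicates.
data Generated {X : Set x} {J : Set j} (B : J → Pred X ℓ) :
               Pred X ℓ → Set (x ⊔ j ⊔ suc ℓ) where
  subbasic     : ∀ i → Generated B (B i)
  whole        : Generated B U
  intersection : ∀ {P Q} → Generated B P → Generated B Q → Generated B (P ∩ Q)
  union        : ∀ {I : Set ℓ} (P : I → Pred X ℓ) →
                 (∀ i → Generated B (P i)) → Generated B (⋃ I P)
  respects     : ∀ {P Q} → P ≐ Q → Generated B P → Generated B Q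

IsCompact : {X : Set x} → (Pred X ℓ → Set j) → Pred X ℓ → Set (x ⊔ j ⊔ suc ℓ)
IsCompact {ℓ = ℓ} {X = X} Open K =
  ∀ {I : Set ℓ} (P : I → Pred X ℓ) → (∀ i → Open (P i)) → K ⊆ ⋃ I P →
  Σ[ is ∈ List I ] K ⊆ λ u → Any (λ i → u ∈ P i) is

module FilterIdeal {c ℓ₁ ℓ₂} (L : BoundedLattice c ℓ₁ ℓ₂)
                   (_⇒_ : Op₂ (BoundedLattice.Carrier L)) where
  open BoundedLattice L using (Carrier; _≤_; _∨_; _∧_)

  private
    s = c ⊔ ℓ₁ ⊔ ℓ₂

  -- Filters and ideals are nonempty but may be improper.
  record IsFilter (F : Pred Carrier s) : Set s where
    field
      nonempty : ∃ λ a → a ∈ F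
      upward   : ∀ {a b} → a ≤ b → a ∈ F → b ∈ F
      ∧-closed : ∀ {a b} → a ∈ F → b ∈ F → (a ∧ b) ∈ F

  record IsIdeal (I : Pred Carrier s) : Set s where
    field
      nonempty : ∃ λ a → a ∈ I
      downward : ∀ {a b} → a ≤ b → b ∈ I → a ∈ I
      ∨-closed : ∀ {a b} → a ∈ I → b ∈ I → (a ∨ b) ∈ I

  record ConsonantPair : Set (suc s) where
    field
      F         : Pred Carrier s
      I         : Pred Carrier s
      isFilter  : IsFilter F
      isIdeal   : IsIdeal I
      consonant : ∀ {a b} → a ∈ F → (a ∧ b) ∈ I → (a ⇒ b) ∈ I

  open ConsonantPair

  _◁_ : Rel ConsonantPair s
  u ◁ v = I u ⊥ F v

  open Frame _◁_ public

  hat : Carrier → Subset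
  hat a u = Lift (suc s) (a ∈ F u)

  IsOpen : Subset → Set (suc (suc s))
  IsOpen = Generated hat

  IsCompactOpen : Subset → Set (suc (suc s))
  IsCompactOpen A = IsCompact IsOpen A × IsOpen A

{-# OPTIONS --safe #-}

-- A point may take the whole lattice as its ideal, so every principal filter ↑a
-- occurs as a filter component; the principal pair (↑a , L) is the least point
-- of hat a, and the condition y ◁ (↑a , L) just says that a is not in the ideal
-- of y.  These points witness the existential in A ⟶ B.  In the other direction,
-- if a ⇒ b is not in the filter of u, then (↑a , ↓(a ⇒ b)) is a consonant pair
-- below u refuting u ∈ hat a ⟶ hat b; the case a = ⊤ shows that hat b is a
-- fixpoint.
-- Opens are upward closed in the filter component, so any open set containing
-- (↑a , L) contains hat a, and hat a is compact.  Conversely the sets hat a form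
-- a base, so a compact open fixpoint is covered by finitely many hat aᵢ inside it
-- and therefore equals hat (⋁ aᵢ).

module Submission where

open import Defs
open import Algebra.Core using (Op₂)
open import Algebra.Definitions using (Congruent₂)
open import Axiom.ExcludedMiddle using (ExcludedMiddle)
open import Algebra.Lattice.Morphism.Structures using (IsLatticeHomomorphism)
open import Data.List.Base using (List; []; _∷_)
open import Data.List.Relation.Unary.Any using (Any; here; there)
open import Data.Product.Base using (Σ-syntax; ∃; _×_; _,_; proj₁; proj₂; swap)
open import Data.Sum.Base using (inj₁; inj₂; [_,_])
open import Function.Base using (_∘_)
open import Level using (Level; _⊔_; suc; Lift; lift; lower)
open import Relation.Binary.Lattice.Bundles using (BoundedLattice)
open import Relation.Binary.Lattice.Properties.JoinSemilattice using (∨-cong)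
open import Relation.Binary.Lattice.Properties.MeetSemilattice using (∧-cong)
open import Relation.Nullary.Decidable.Core using (yes; no; decidable-stable)
open import Relation.Nullary.Negation.Core using (contradiction)
open import Relation.Unary using (Pred; _∈_; _∉_; _⊆_; _≐_; _∩_; _∪_; ⋃)
open import Relation.Unary.Properties using (≐-refl)
open import Relation.Unary.Polymorphic using (U; ∅)

private
  variable
    a b ℓ ℓ₁ ℓ₂ ℓ₁′ ℓ₂′ : Level

-- Equality in a subalgebra is inherited along `proj₁`, so every law of `emb` serves unchanged.
subalgebra-isEmbedding :
  {A : LatticeWithOp a ℓ₁ ℓ₂} (B : LatticeWithOp b ℓ₁′ ℓ₂′) →
  let module A = LatticeWithOp A
      module B = LatticeWithOp B
  in
  {P : Pred B.Carrier ℓ} (sub : IsSubuniverse B P) {h : A.Carrier → B.Carrier} →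
  IsEmbedding A B h → (h∈P : ∀ x → h x ∈ P) →
  IsEmbedding A (subalgebra B P sub) (λ x → h x , h∈P x)
subalgebra-isEmbedding B sub emb h∈P = record
  { isHomomorphism = record
    { isLatticeHomomorphism = record
      { isRelHomomorphism = record { cong = ⟦⟧-cong }
      ; ∧-homo = ∧-homo
      ; ∨-homo = ∨-homo
      }
    ; ⊤-homo = ⊤-homo
    ; ⊥-homo = ⊥-homo
    ; ⇒-homo = ⇒-homo
    }
  ; injective = injective
  }
  where
  open IsEmbedding emb
  open IsHomomorphism isHomomorphism
  open IsLatticeHomomorphism isLatticeHomomorphism

module Representation {c ℓ₁ ℓ₂} (em : ExcludedMiddle (c ⊔ ℓ₁ ⊔ ℓ₂))
  (L : BoundedLattice c ℓ₁ ℓ₂) (_⇒_ : Op₂ (BoundedLattice.Carrier L))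
  (isPreconditional : IsPreconditional L _⇒_) where

  open BoundedLattice L
  open IsPreconditional isPreconditional
  open FilterIdeal L _⇒_
  open ConsonantPair
  private
    module 𝔏 = LatticeWithOp 𝔏

  -- Principal filters and ideals as consonant pairs.

  ⇒-monoʳ : ∀ {a b d} → b ≤ d → (a ⇒ b) ≤ (a ⇒ d)
  ⇒-monoʳ {a} {b} {d} b≤d = trans
    -- Rewriting `b` as `d ∧ b` makes `⇒∧≤⇒` applicable.
    (reflexive (⇒-cong Eq.refl (antisym (∧-greatest b≤d refl) (x∧y≤y d b))))
    (⇒∧≤⇒ a d b)

  ↑ : Carrier → Pred Carrier (c ⊔ ℓ₁ ⊔ ℓ₂)
  ↑ a x = Lift (c ⊔ ℓ₁) (a ≤ x)

  ↓ : Carrier → Pred Carrier (c ⊔ ℓ₁ ⊔ ℓ₂)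
  ↓ a x = Lift (c ⊔ ℓ₁) (x ≤ a)

  ↑-isFilter : ∀ a → IsFilter (↑ a)
  ↑-isFilter a = record
    { nonempty = a , lift refl
    ; upward   = λ x≤y (lift a≤x) → lift (trans a≤x x≤y)
    ; ∧-closed = λ (lift a≤x) (lift a≤y) → lift (∧-greatest a≤x a≤y)
    }

  ↓-isIdeal : ∀ a → IsIdeal (↓ a)
  ↓-isIdeal a = record
    { nonempty = a , lift refl
    ; downward = λ x≤y (lift y≤a) → lift (trans x≤y y≤a)
    ; ∨-closed = λ (lift x≤a) (lift y≤a) → lift (∨-least x≤a y≤a)
    }

  principal : Carrier → ConsonantPair
  principal a = record
    { F         = ↑ a
    ; I         = U
    ; isFilter  = ↑-isFilter a
    ; isIdeal   = record { nonempty = a , _ }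
    ; consonant = _
    }

  refuting : Carrier → Carrier → ConsonantPair
  refuting a b = record
    { F         = ↑ a
    ; I         = ↓ (a ⇒ b)
    ; isFilter  = ↑-isFilter a
    ; isIdeal   = ↓-isIdeal (a ⇒ b)
    ; consonant = λ (lift a≤x) (lift x∧y≤a⇒b) → lift (consonance a≤x x∧y≤a⇒b)
    }
    where
    consonance : ∀ {x y} → a ≤ x → (x ∧ y) ≤ (a ⇒ b) → (x ⇒ y) ≤ (a ⇒ b)
    consonance {x} {y} a≤x x∧y≤a⇒b =
      -- The first two steps reach `x ⇒ (a ⇒ b)`. Replacing `a` by `x ∧ a` gives it the shape from
      -- which `⇒⇒≤⇒` removes the outer antecedent.
      trans (⇒≤⇒∧ x y)
      (trans (⇒-monoʳ x∧y≤a⇒b)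
      (trans (reflexive (⇒-cong Eq.refl (⇒-cong a≈x∧a Eq.refl)))
      (trans (⇒⇒≤⇒ x a b)
      (reflexive (⇒-cong (Eq.sym a≈x∧a) Eq.refl)))))
      where
      a≈x∧a : a ≈ (x ∧ a)
      a≈x∧a = antisym (∧-greatest a≤x refl) (x∧y≤y x a)

  ∉I⇒◁principal : ∀ {y a} → a ∉ I y → y ◁ principal a
  ∉I⇒◁principal {y} a∉I (x∈I , lift a≤x) =
    a∉I (IsIdeal.downward (isIdeal y) a≤x x∈I)

  -- Basic sets and the lattice operations.

  hat-mono : ∀ {a b} → a ≤ b → hat a ⊆ hat b
  hat-mono a≤b {u} (lift a∈F) = lift (IsFilter.upward (isFilter u) a≤b a∈F)

  hat-cong : ∀ {a b} → a ≈ b → hat a ≐ hat b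
  hat-cong a≈b =
    (λ {u} → hat-mono (reflexive a≈b) {u}) ,
    (λ {u} → hat-mono (reflexive (Eq.sym a≈b)) {u})

  hat-cancel : ∀ {a b} → hat a ⊆ hat b → a ≤ b
  hat-cancel {a} ha⊆hb = lower (lower (ha⊆hb {principal a} (lift (lift refl))))

  hat-⇒ : ∀ a b → hat (a ⇒ b) ≐ (hat a ⟶ hat b)
  hat-⇒ a b = (λ {u} → to {u}) , (λ {u} → from {u})
    where
    to : hat (a ⇒ b) ⊆ (hat a ⟶ hat b)
    to {u} (lift a⇒b∈F) y y◁u (lift a∈F) =
      -- If `a ∧ b` were in the ideal of `y`, consonance would put `a ⇒ b` there too, against
      -- `y ◁ u`.
      principal (a ∧ b) ,
      ∉I⇒◁principal {y} (λ a∧b∈I → y◁u (consonant y a∈F a∧b∈I , a⇒b∈F)) ,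
      lift (lift (x∧y≤x a b)) , lift (lift (x∧y≤y a b))

    from : (hat a ⟶ hat b) ⊆ hat (a ⇒ b)
    from {u} u∈⟶ = lift (decidable-stable em λ a⇒b∉F →
      let y◁u : refuting a b ◁ u
          y◁u = λ (lift x≤a⇒b , x∈F) →
            a⇒b∉F (IsFilter.upward (isFilter u) x≤a⇒b x∈F)
          z , y◁z , lift a∈Fz , lift b∈Fz =
            u∈⟶ (refuting a b) y◁u (lift (lift refl))
      -- The element `a ∧ b` lies in the filter of `z` and, by `∧≤⇒`, in the ideal `↓ (a ⇒ b)`.
      in y◁z (lift (∧≤⇒ a b) , IsFilter.∧-closed (isFilter z) a∈Fz b∈Fz))

  hat-⊤ : hat ⊤ ≐ proj₁ 𝔏.⊤
  hat-⊤ = _ , λ {u} _ →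
    let x , x∈F = IsFilter.nonempty (isFilter u)
    in lift (IsFilter.upward (isFilter u) (maximum x) x∈F)

  -- Since `U` is `hat ⊤`, the closure is `hat (⊤ ⇒ a)`, and `⊤⇒` bounds `⊤ ⇒ a` by `a`.
  hat-isFixpoint : ∀ a → IsFixpoint (hat a)
  hat-isFixpoint a =
    (λ {u} u∈cl → hat-mono (⊤⇒ a) {u} (proj₂ (hat-⇒ ⊤ a) {u}
      (proj₁ (⟶-cong {U} {hat ⊤} {hat a} {hat a} (swap hat-⊤) ≐-refl) {u} u∈cl))) ,
    (λ {u} → cl-extensive (hat a) {u})

  hatᶠ : Carrier → Fixpoint
  hatᶠ a = hat a , hat-isFixpoint a

  -- Every ideal contains `⊥`, so a point with `⊥` in its filter has no predecessor and the closure
  -- condition is vacuous.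
  hat-⊥⊆ : hat ⊥ ⊆ cl ∅
  hat-⊥⊆ (lift ⊥∈F) y y◁u _ =
    let x , x∈I = IsIdeal.nonempty (isIdeal y)
    in contradiction (IsIdeal.downward (isIdeal y) (minimum x) x∈I , ⊥∈F) y◁u

  hat-⊥ : hat ⊥ ≐ cl ∅
  hat-⊥ = (λ {u} → hat-⊥⊆ {u}) , (λ {u} → 𝔏.minimum (hatᶠ ⊥) {u})

  hat-∧ : ∀ a b → hat (a ∧ b) ≐ (hat a ∩ hat b)
  hat-∧ a b =
    (λ {u} p → hat-mono (x∧y≤x a b) {u} p , hat-mono (x∧y≤y a b) {u} p) ,
    λ { {u} (lift a∈F , lift b∈F) →
        lift (IsFilter.∧-closed (isFilter u) a∈F b∈F) }

  -- An ideal containing both `a` and `b` contains `a ∨ b`; so the ideal of `y` misses one of them,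
  -- and that one's principal pair is the witness.
  hat-∨⊆ : ∀ a b → hat (a ∨ b) ⊆ cl (hat a ∪ hat b)
  hat-∨⊆ a b {u} (lift a∨b∈F) y y◁u _ with em {a ∈ I y}
  ... | no a∉I = principal a , ∉I⇒◁principal {y} a∉I , _ , inj₁ (lift (lift refl))
  ... | yes a∈I = principal b , ∉I⇒◁principal {y} b∉I , _ , inj₂ (lift (lift refl))
    where
    b∉I : b ∉ I y
    b∉I b∈I = y◁u (IsIdeal.∨-closed (isIdeal y) a∈I b∈I , a∨b∈F)

  hat-∨ : ∀ a b → hat (a ∨ b) ≐ cl (hat a ∪ hat b)
  hat-∨ a b = (λ {u} → hat-∨⊆ a b {u}) , λ {u} →
    𝔏.∨-least {hatᶠ a} {hatᶠ b} {hatᶠ (a ∨ b)}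
      (λ {v} → hat-mono (x≤x∨y a b) {v}) (λ {v} → hat-mono (y≤x∨y a b) {v}) {u}

  hat-isEmbedding : IsEmbedding (withPreconditional L _⇒_ isPreconditional) 𝔏 hatᶠ
  hat-isEmbedding = record
    { isHomomorphism = record
      { isLatticeHomomorphism = record
        { isRelHomomorphism = record { cong = hat-cong }
        ; ∧-homo = hat-∧
        ; ∨-homo = hat-∨
        }
      ; ⊤-homo = hat-⊤
      ; ⊥-homo = hat-⊥
      ; ⇒-homo = hat-⇒
      }
    ; injective = λ (ha⊆hb , hb⊆ha) → antisym
        (hat-cancel λ {u} → ha⊆hb {u}) (hat-cancel λ {u} → hb⊆ha {u})
    }

  -- Compact open sets.

  open-basis : ∀ {O} → IsOpen O → ∀ {u} → u ∈ O → ∃ λ a → u ∈ hat a × hat a ⊆ O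
  open-basis (subbasic a) u∈ = a , u∈ , λ p → p
  open-basis whole {u} _ = ⊤ , proj₂ hat-⊤ {u} _ , _
  -- By `hat-∧` the basic sets are closed under binary intersection, so they form a base.
  open-basis (intersection oP oQ) {u} (u∈P , u∈Q) =
    let a , u∈a , a⊆P = open-basis oP u∈P
        b , u∈b , b⊆Q = open-basis oQ u∈Q
    in a ∧ b , proj₂ (hat-∧ a b) {u} (u∈a , u∈b) ,
       λ {v} p → let p₁ , p₂ = proj₁ (hat-∧ a b) {v} p in a⊆P p₁ , b⊆Q p₂
  open-basis (union P oP) (i , u∈Pi) =
    let a , u∈a , a⊆P = open-basis (oP i) u∈Pi
    in a , u∈a , λ p → i , a⊆P p
  open-basis (respects (P⊆Q , Q⊆P) oP) u∈Q =
    let a , u∈a , a⊆P = open-basis oP (Q⊆P u∈Q)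
    in a , u∈a , λ p → P⊆Q (a⊆P p)

  hat-isCompactOpen : ∀ a → IsCompactOpen (hat a)
  hat-isCompactOpen a = compact , subbasic a
    where
    compact : IsCompact IsOpen (hat a)
    compact P oP cover =
      let i , pa∈Pi = cover {principal a} (lift (lift refl))
          b , pa∈b , b⊆Pi = open-basis (oP i) pa∈Pi
      in i ∷ [] , λ {u} u∈a → here (b⊆Pi (hat-mono (lower (lower pa∈b)) {u} u∈a))

  isCompactOpen-resp : ∀ {A B} → A ≐ B → IsCompactOpen A → IsCompactOpen B
  isCompactOpen-resp (A⊆B , B⊆A) (compact , isOpen) =
    (λ P oP cover →
      let is , A⊆ = compact P oP (λ p → cover (A⊆B p)) in is , λ p → A⊆ (B⊆A p)) ,
    respects (A⊆B , B⊆A) isOpen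

  compactOpen⇒hat : ∀ (A : Fixpoint) → IsCompactOpen (proj₁ A) →
                    ∃ λ a → hat a ≐ proj₁ A
  compactOpen⇒hat (A , clA⊆A , _) (compact , isOpen) =
    let bs , A⊆bs = compact (hat ∘ proj₁) (subbasic ∘ proj₁) cover
    in ⋁ bs , ⋁⊆A bs , λ {u} u∈A → any⇒⋁ bs {u} (A⊆bs u∈A)
    where
    -- Each index carries the proof that its basic set lies in `A`, so a finite subcover retains it.
    Below : Set (suc (c ⊔ ℓ₁ ⊔ ℓ₂))
    Below = Σ[ a ∈ Carrier ] hat a ⊆ A

    cover : A ⊆ ⋃ Below (hat ∘ proj₁)
    cover u∈A = let a , u∈a , a⊆A = open-basis isOpen u∈A in (a , a⊆A) , u∈a

    ⋁ : List Below → Carrier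
    ⋁ []             = ⊥
    ⋁ ((a , _) ∷ bs) = a ∨ ⋁ bs

    -- Joins correspond to closures of unions, which `A` absorbs because it is a fixpoint.
    ⋁⊆A : ∀ bs → hat (⋁ bs) ⊆ A
    ⋁⊆A []               {u} p = clA⊆A (cl-mono {∅} {A} (λ ()) {u} (hat-⊥⊆ {u} p))
    ⋁⊆A ((a , a⊆A) ∷ bs) {u} p =
      clA⊆A (cl-mono {hat a ∪ hat (⋁ bs)} {A} [ a⊆A , ⋁⊆A bs ] {u}
        (hat-∨⊆ a (⋁ bs) {u} p))

    any⇒⋁ : ∀ bs {u} → Any (λ b → u ∈ hat (proj₁ b)) bs → u ∈ hat (⋁ bs)
    any⇒⋁ (_ ∷ _)  {u} (here p)  = hat-mono (x≤x∨y _ _) {u} p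
    any⇒⋁ (_ ∷ bs) {u} (there p) = hat-mono (y≤x∨y _ _) {u} (any⇒⋁ bs {u} p)

  -- Both arguments have the form `hat`, and `homo` makes the result `hat (a ◦ b)`. One argument
  -- thus serves meet, join and implication.
  compactOpen-closed : ∀ {_∙_ : Op₂ Fixpoint} (_◦_ : Op₂ Carrier) →
    Congruent₂ 𝔏._≈_ _∙_ → (∀ a b → hatᶠ (a ◦ b) 𝔏.≈ (hatᶠ a ∙ hatᶠ b)) →
    ∀ A B → IsCompactOpen (proj₁ A) → IsCompactOpen (proj₁ B) →
    IsCompactOpen (proj₁ (A ∙ B))
  compactOpen-closed {_∙_} _◦_ ∙-cong homo A B coA coB =
    let a , ha≈A = compactOpen⇒hat A coA
        b , hb≈B = compactOpen⇒hat B coB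
    in isCompactOpen-resp
         (𝔏.Eq.trans {hatᶠ (a ◦ b)} {hatᶠ a ∙ hatᶠ b} {A ∙ B} (homo a b)
           (∙-cong {hatᶠ a} {A} {hatᶠ b} {B} ha≈A hb≈B))
         (hat-isCompactOpen (a ◦ b))

  compactOpen-isSubuniverse : IsSubuniverse 𝔏 (IsCompactOpen ∘ proj₁)
  compactOpen-isSubuniverse = record
    { ⊤-closed = isCompactOpen-resp hat-⊤ (hat-isCompactOpen ⊤)
    ; ⊥-closed = isCompactOpen-resp hat-⊥ (hat-isCompactOpen ⊥)
    ; ∧-closed = λ {A} {B} → compactOpen-closed {𝔏._∧_} _∧_
        (λ {A} {B} {C} {D} → ∧-cong 𝔏.meetSemilattice {A} {B} {C} {D}) hat-∧ A B
    ; ∨-closed = λ {A} {B} → compactOpen-closed {𝔏._∨_} _∨_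
        (λ {A} {B} {C} {D} → ∨-cong 𝔏.joinSemilattice {A} {B} {C} {D}) hat-∨ A B
    ; ⇒-closed = λ {A} {B} → compactOpen-closed {𝔏._⇒_} _⇒_ ⟶-cong hat-⇒ A B
    }

  hat-isIsomorphism : IsIsomorphism (withPreconditional L _⇒_ isPreconditional)
    (subalgebra 𝔏 (IsCompactOpen ∘ proj₁) compactOpen-isSubuniverse)
    (λ a → hatᶠ a , hat-isCompactOpen a)
  hat-isIsomorphism = record
    { isEmbedding = subalgebra-isEmbedding 𝔏 compactOpen-isSubuniverse
        hat-isEmbedding hat-isCompactOpen
    ; surjective = λ (A , coA) →
        let a , ha≈A = compactOpen⇒hat A coA
        in a , λ {b} b≈a →
             𝔏.Eq.trans {hatᶠ b} {hatᶠ a} {A} (hat-cong b≈a) ha≈A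
    }

theorem2 : ∀ {c ℓ₁ ℓ₂} → ExcludedMiddle (c ⊔ ℓ₁ ⊔ ℓ₂) →
  (L : BoundedLattice c ℓ₁ ℓ₂) (_⇒_ : Op₂ (BoundedLattice.Carrier L))
  (isPreconditional : IsPreconditional L _⇒_) →
  let 𝐋 = withPreconditional L _⇒_ isPreconditional
      open FilterIdeal L _⇒_
  in
  Σ[ fix ∈ (∀ a → IsFixpoint (hat a)) ]
    IsEmbedding 𝐋 𝔏 (λ a → hat a , fix a)
    × (Σ[ co ∈ (∀ a → IsCompactOpen (hat a)) ]
       Σ[ sub ∈ IsSubuniverse 𝔏 (IsCompactOpen ∘ proj₁) ]
         IsIsomorphism 𝐋 (subalgebra 𝔏 (IsCompactOpen ∘ proj₁) sub)
           (λ a → (hat a , fix a) , co a))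
theorem2 em L _⇒_ isPreconditional =
  hat-isFixpoint , hat-isEmbedding ,
  hat-isCompactOpen , compactOpen-isSubuniverse , hat-isIsomorphism
  where open Representation em L _⇒_ isPreconditional
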